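{- Let $k\in\mathbb{N}_0$ and $n\in\mathbb{N}_0$. Then \[ n\, t_k(n) = k \sum_{j=0}^{n-1} t_k (j) \left( \sigma(n-j)- 4 \sigma\!\left(\tfrac{n-j}{2}\right) \right). \]
   Context: For $k\in\mathbb{N}_0$ and $n\in\mathbb{N}_0$, $t_k(n)=\#\{(x_1,\dots,x_k)\in\mathbb{N}_0^k : n=\sum_{i=1}^k \frac{x_i(x_i+1)}{2}\}$, where $\mathbb{N}_0=\{0,1,2,\dots\}$ (so $t_k(0)=1$). The function $\sigma$ is defined on $\mathbb{Q}$ by $\sigma(0)=1$, $\sigma(q)=0$ if $q\in\mathbb{Q}\setminus\mathbb{N}_0$, and $\sigma(q)=\sum_{d\mid q} d$ for $q\in\mathbb{N}=\{1,2,\dots\}$. -}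

module Defs where

open import Data.Nat using (ℕ; zero; suc; _+_; _*_; _/_; _%_; _≟_)
open import Data.Nat.Divisibility using (_∣?_)
open import Data.Integer as ℤ using (ℤ; +_)
open import Data.Fin using (Fin; toℕ)
open import Data.Vec using (Vec; []; _∷_)
open import Data.List using (List; []; _∷_; length; filter; map; upTo; concatMap)
open import Data.Nat.ListAction using (sum)
open import Relation.Nullary.Decidable using (⌊_⌋)
open import Data.Bool using (if_then_else_)

tri : ℕ → ℕ
tri x = (x * suc x) / 2

vecsUpTo : ℕ → (k : ℕ) → List (Vec ℕ k)
vecsUpTo m zero = [] ∷ []
vecsUpTo m (suc k) = concatMap (λ x → map (x ∷_) (vecsUpTo m k)) (upTo (suc m))

sumTri : ∀ {k} → Vec ℕ k → ℕ
sumTri [] = 0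
sumTri (x ∷ xs) = tri x + sumTri xs

-- t_k(n) = #{x ∈ ℕ₀^k : n = Σ x_i(x_i+1)/2}.  Any solution has x_i ≤ n
-- (since x ≤ x(x+1)/2), so it suffices to enumerate x_i ∈ {0,…,n}.
t : ℕ → ℕ → ℕ
t k n = length (filter (λ v → n ≟ sumTri v) (vecsUpTo n k))

-- σ on positive naturals: sum of divisors (σ 0 = 1 as in the paper)
σ : ℕ → ℕ
σ zero = 1
σ (suc m) = sum (filter (λ d → d ∣? suc m) (map suc (upTo (suc m))))

-- σ(m/2) for the rational m/2 with m ∈ ℕ: 0 if m odd, else σ(m/2)
σHalf : ℕ → ℕ
σHalf m = if ⌊ m % 2 ≟ 0 ⌋ then σ (m / 2) else 0

sumBelow : ℕ → (ℕ → ℤ) → ℤ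
sumBelow zero f = + 0
sumBelow (suc n) f = sumBelow n f ℤ.+ f n

{-# OPTIONS --safe #-}
-- Work modulo q^N in ℤ[[q]] with the derivation θ = q d/dq, and let ψ = Σ q^tri(i), so that the
-- t_k(n) are the coefficients of ψᵏ.  By the Leibniz rule everything follows from θψ = S ψ,
-- where S = Σ_{m≥1} (σ(m) − 4 σ(m/2)) qᵐ.  This is the logarithmic derivative of Gauss's product
-- ψ = Π (1 − q²ⁱ) / (1 − q²ⁱ⁻¹), taken after clearing denominators: a factor 1 − qᵐ contributes
-- the Lambert series −Σ_{k≥1} m qᵐᵏ.  Gauss's product comes from Shanks's finite form
--   Π_{i≤n} (1 − q²ⁱ⁻¹) · Σ_{i<2n} q^tri(i)
--     = Σ_{s<n} q^(s(2n+1)) Π_{i≤s} (1 − q²ⁱ⁻¹) Π_{s<i≤n} (1 − q²ⁱ),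
-- proved by induction on n, in which only the term s = 0 survives modulo q²ⁿ⁺¹.

module Submission where

open import Defs
open import Data.Nat using (ℕ; _∸_)
open import Data.Integer using (ℤ; +_; _*_; _-_)
open import Relation.Binary.PropositionalEquality using (_≡_)

open import Algebra.Bundles using (CommutativeRing)
import Algebra.Properties.CommutativeSemiring.Exp
import Algebra.Properties.Group
import Algebra.Solver.Ring
open import Algebra.Solver.Ring.AlmostCommutativeRing
  using (fromCommutativeRing; _-Raw-AlmostCommutative⟶_)
open import Data.Bool using (true; false; if_then_else_)
open import Data.Integer as ℤ using (0ℤ; 1ℤ)
import Data.Integer.Properties as ℤₚ
open import Data.Integer.Solver using (module +-*-Solver)
open import Data.List
  using (List; []; _∷_; [_]; _++_; length; filter; map; upTo; concatMap)
open import Data.List.Properties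
  using (upTo-∷ʳ; concatMap-++; ++-identityʳ; filter-++; map-++; length-++)
open import Data.Maybe using (Maybe; just; nothing)
open import Data.Nat as ℕ using (zero; suc; z≤n; s≤s)
open import Data.Nat.Divisibility
  using (divides; _∣_; _∣?_; ∣-refl; ∣-reflexive; ∣-trans; >⇒∤; ∣m+n∣m⇒∣n; ∣m∣n⇒∣m+n;
         *-cancelʳ-∣; *-monoˡ-∣)
open import Data.Nat.DivMod using (+-distrib-/-∣ˡ; m*n/n≡m; m*n%n≡0; [m+kn]%n≡m%n)
open import Data.Nat.ListAction using (sum)
open import Data.Nat.ListAction.Properties using (sum-++)
import Data.Nat.Properties as ℕₚ
import Data.Nat.Solver
open import Data.Product using (_,_)
open import Data.Vec using (Vec; _∷_)
open import Function using (_∘_)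
open import Function.Bundles using (mk⇔)
open import Level using (0ℓ)
open import Relation.Binary.PropositionalEquality
  using (refl; sym; trans; cong; cong₂; subst; module ≡-Reasoning)
import Relation.Binary.Reasoning.Setoid
open import Relation.Nullary using (¬_; yes; no; does)
open import Relation.Nullary.Decidable using (⌊_⌋; does-⇔; dec-true; dec-false)

module ℕ-Solver = Data.Nat.Solver.+-*-Solver

-- Formal power series

Series : Set
Series = ℕ → ℤ

infixl 6 _⊕_
infixl 7 _⊛_ _·_
infix 8 ⊖_

tail : Series → Series
tail f i = f (suc i)

const : ℤ → Series
const c zero    = c
const c (suc _) = 0ℤ

_⊕_ : Series → Series → Series
(f ⊕ g) i = f i ℤ.+ g i

⊖_ : Series → Series
(⊖ f) i = ℤ.- f i

_·_ : ℤ → Series → Series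
(c · f) i = c * f i

-- The Cauchy product, read off from f · g = f(0) g + q · (tail f) · g. Proofs about it run by
-- induction on the index, with the left factor replaced by its tail.
_⊛_ : Series → Series → Series
(f ⊛ g) zero    = f 0 * g 0
(f ⊛ g) (suc i) = f 0 * g (suc i) ℤ.+ (tail f ⊛ g) i

θ : Series → Series
θ f i = + i * f i

-- The i-th coefficient of a product involves no coefficient beyond i; this makes multiplication
-- well defined modulo q^N.
⊛-cong-≤ : ∀ {f f′ g g′} i → (∀ {j} → j ℕ.≤ i → f j ≡ f′ j) →
           (∀ {j} → j ℕ.≤ i → g j ≡ g′ j) → (f ⊛ g) i ≡ (f′ ⊛ g′) i
⊛-cong-≤ zero    p q = cong₂ _*_ (p z≤n) (q z≤n)
⊛-cong-≤ (suc i) p q = cong₂ ℤ._+_ (cong₂ _*_ (p z≤n) (q ℕₚ.≤-refl))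
  (⊛-cong-≤ i (λ j≤i → p (s≤s j≤i)) (λ j≤i → q (ℕₚ.m≤n⇒m≤1+n j≤i)))

⊛-distribʳ : ∀ h f g i → ((f ⊕ g) ⊛ h) i ≡ (f ⊛ h ⊕ g ⊛ h) i
⊛-distribʳ h f g zero    = ℤₚ.*-distribʳ-+ (h 0) (f 0) (g 0)
⊛-distribʳ h f g (suc i) = trans
  (cong (λ z → (f 0 ℤ.+ g 0) * h (suc i) ℤ.+ z) (⊛-distribʳ h (tail f) (tail g) i))
  (solve 5 (λ a b c d e → (a :+ b) :* c :+ (d :+ e) := (a :* c :+ d) :+ (b :* c :+ e)) refl
    (f 0) (g 0) (h (suc i)) ((tail f ⊛ h) i) ((tail g ⊛ h) i))
  where open +-*-Solver

·-⊛-assoc : ∀ c f g i → ((c · f) ⊛ g) i ≡ (c · (f ⊛ g)) i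
·-⊛-assoc c f g zero    = ℤₚ.*-assoc c (f 0) (g 0)
·-⊛-assoc c f g (suc i) = trans
  (cong (λ z → c * f 0 * g (suc i) ℤ.+ z) (·-⊛-assoc c (tail f) g i))
  (solve 4 (λ a b d e → a :* b :* d :+ a :* e := a :* (b :* d :+ e)) refl
    c (f 0) (g (suc i)) ((tail f ⊛ g) i))
  where open +-*-Solver

⊛-assoc : ∀ f g h i → ((f ⊛ g) ⊛ h) i ≡ (f ⊛ (g ⊛ h)) i
⊛-assoc f g h zero    = ℤₚ.*-assoc (f 0) (g 0) (h 0)
⊛-assoc f g h (suc i) = begin
  f 0 * g 0 * h (suc i) ℤ.+ ((f 0 · tail g ⊕ tail f ⊛ g) ⊛ h) i
    ≡⟨ cong (λ z → f 0 * g 0 * h (suc i) ℤ.+ z) (trans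
         (⊛-distribʳ h (f 0 · tail g) (tail f ⊛ g) i)
         (cong₂ ℤ._+_ (·-⊛-assoc (f 0) (tail g) h i) (⊛-assoc (tail f) g h i))) ⟩
  f 0 * g 0 * h (suc i) ℤ.+ (f 0 * (tail g ⊛ h) i ℤ.+ (tail f ⊛ (g ⊛ h)) i)
    ≡⟨ solve 5 (λ a b c d e → a :* b :* c :+ (a :* d :+ e) := a :* (b :* c :+ d) :+ e) refl
         (f 0) (g 0) (h (suc i)) ((tail g ⊛ h) i) ((tail f ⊛ (g ⊛ h)) i) ⟩
  f 0 * (g 0 * h (suc i) ℤ.+ (tail g ⊛ h) i) ℤ.+ (tail f ⊛ (g ⊛ h)) i ∎
  where open ≡-Reasoning
        open +-*-Solver

-- The mirror image of the defining clause: the constant term is split off the right factor.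
-- Commutativity and cancellation both rest on it.
⊛-suc : ∀ f g i → (f ⊛ g) (suc i) ≡ f (suc i) * g 0 ℤ.+ (f ⊛ tail g) i
⊛-suc f g zero    = ℤₚ.+-comm (f 0 * g 1) (f 1 * g 0)
⊛-suc f g (suc i) = trans
  (cong (λ z → f 0 * g (suc (suc i)) ℤ.+ z) (⊛-suc (tail f) g i))
  (solve 3 (λ a b c → a :+ (b :+ c) := b :+ (a :+ c)) refl
    (f 0 * g (suc (suc i))) (f (suc (suc i)) * g 0) ((tail f ⊛ tail g) i))
  where open +-*-Solver

⊛-comm : ∀ f g i → (f ⊛ g) i ≡ (g ⊛ f) i
⊛-comm f g zero    = ℤₚ.*-comm (f 0) (g 0)
⊛-comm f g (suc i) = trans (⊛-suc f g i)
  (cong₂ ℤ._+_ (ℤₚ.*-comm (f (suc i)) (g 0)) (⊛-comm f (tail g) i))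

⊛-zeroˡ : ∀ {f} g i → (∀ j → f j ≡ 0ℤ) → (f ⊛ g) i ≡ 0ℤ
⊛-zeroˡ g zero    f≡0 = cong (_* g 0) (f≡0 0)
⊛-zeroˡ g (suc i) f≡0 = cong₂ ℤ._+_ (cong (_* g (suc i)) (f≡0 0)) (⊛-zeroˡ g i (f≡0 ∘ suc))

const-0 : ∀ i → const 0ℤ i ≡ 0ℤ
const-0 zero    = refl
const-0 (suc _) = refl

const-⊛ : ∀ c f i → (const c ⊛ f) i ≡ c * f i
const-⊛ c f zero    = refl
const-⊛ c f (suc i) = trans (cong (λ z → c * f (suc i) ℤ.+ z) (⊛-zeroˡ f i (λ _ → refl)))
                            (ℤₚ.+-identityʳ _)

θ-⊛ : ∀ f g i → θ (f ⊛ g) i ≡ (θ f ⊛ g ⊕ f ⊛ θ g) i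
θ-⊛ f g zero    = sym (trans (ℤₚ.+-identityˡ _) (ℤₚ.*-zeroʳ (f 0)))
θ-⊛ f g (suc i) = begin
  + suc i * (f 0 * g (suc i) ℤ.+ (tail f ⊛ g) i)
    ≡⟨ solve 4 (λ n a b c → (con 1ℤ :+ n) :* (a :* b :+ c)
                 := con 0ℤ :* b :+ c :+ n :* c :+ a :* ((con 1ℤ :+ n) :* b)) refl
         (+ i) (f 0) (g (suc i)) ((tail f ⊛ g) i) ⟩
  0ℤ * g (suc i) ℤ.+ (tail f ⊛ g) i ℤ.+ θ (tail f ⊛ g) i ℤ.+ f 0 * θ g (suc i)
    ≡⟨ cong (λ z → 0ℤ * g (suc i) ℤ.+ (tail f ⊛ g) i ℤ.+ z ℤ.+ f 0 * θ g (suc i))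
            (θ-⊛ (tail f) g i) ⟩
  0ℤ * g (suc i) ℤ.+ (tail f ⊛ g) i ℤ.+ ((θ (tail f) ⊛ g) i ℤ.+ (tail f ⊛ θ g) i)
    ℤ.+ f 0 * θ g (suc i)
    ≡⟨ solve 5 (λ z a b c d → z :+ a :+ (b :+ c) :+ d := z :+ (a :+ b) :+ (d :+ c)) refl
         (0ℤ * g (suc i)) ((tail f ⊛ g) i) ((θ (tail f) ⊛ g) i) ((tail f ⊛ θ g) i)
         (f 0 * θ g (suc i)) ⟩
  0ℤ * g (suc i) ℤ.+ ((tail f ⊛ g) i ℤ.+ (θ (tail f) ⊛ g) i)
    ℤ.+ (f 0 * θ g (suc i) ℤ.+ (tail f ⊛ θ g) i)
    ≡⟨ cong (λ z → 0ℤ * g (suc i) ℤ.+ z ℤ.+ (f 0 * θ g (suc i) ℤ.+ (tail f ⊛ θ g) i))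
            (sym (⊛-distribʳ g (tail f) (θ (tail f)) i)) ⟩
  0ℤ * g (suc i) ℤ.+ ((tail f ⊕ θ (tail f)) ⊛ g) i ℤ.+ (f ⊛ θ g) (suc i)
    -- Passing to the tail lowers each index by one, so `tail (θ f)` is `tail f ⊕ θ (tail f)`.
    ≡⟨ cong (λ z → 0ℤ * g (suc i) ℤ.+ z ℤ.+ (f ⊛ θ g) (suc i))
            (⊛-cong-≤ i (λ {j} _ → sym (ℤₚ.suc-* (+ j) (f (suc j)))) (λ _ → refl)) ⟩
  (θ f ⊛ g) (suc i) ℤ.+ (f ⊛ θ g) (suc i) ∎
  where open ≡-Reasoning
        open +-*-Solver

-- The ring ℤ[[q]]/(q^N)

infix 4 _≈[_]_

-- Congruence modulo q^N, wrapped in a record so that both series and the modulus can be inferred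
-- from the type.
record _≈[_]_ (f : Series) (N : ℕ) (g : Series) : Set where
  constructor below
  field coeff : ∀ {i} → i ℕ.< N → f i ≡ g i

open _≈[_]_

exactly : ∀ {N f g} → (∀ i → f i ≡ g i) → f ≈[ N ] g
exactly p = below λ {i} _ → p i

seriesRing : ℕ → CommutativeRing 0ℓ 0ℓ
seriesRing N = record
  { _≈_ = _≈[ N ]_
  ; _+_ = _⊕_
  ; _*_ = _⊛_
  ; -_  = ⊖_
  ; 0#  = const 0ℤ
  ; 1#  = const 1ℤ
  ; isCommutativeRing = record
    { isRing = record
      { +-isAbelianGroup = record
        { isGroup = record
          { isMonoid = record
            { isSemigroup = record
              { isMagma = record
                { isEquivalence = record
                  { refl  = exactly λ _ → refl
                  ; sym   = λ p → below λ i<N → sym (coeff p i<N)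
                  ; trans = λ p q → below λ i<N → trans (coeff p i<N) (coeff q i<N)
                  }
                ; ∙-cong = λ p q → below λ i<N → cong₂ ℤ._+_ (coeff p i<N) (coeff q i<N)
                }
              ; assoc = λ f g h → exactly λ i → ℤₚ.+-assoc (f i) (g i) (h i)
              }
            ; identity = (λ f → exactly (identityˡ f))
                       , (λ f → exactly λ i → trans (ℤₚ.+-comm (f i) _) (identityˡ f i))
            }
          ; inverse = (λ f → exactly (inverseˡ f))
                    , (λ f → exactly λ i → trans (ℤₚ.+-comm (f i) _) (inverseˡ f i))
          ; ⁻¹-cong = λ p → below λ i<N → cong ℤ.-_ (coeff p i<N)
          }
        ; comm = λ f g → exactly λ i → ℤₚ.+-comm (f i) (g i)
        }
      ; *-cong = λ p q → below λ {i} i<N → ⊛-cong-≤ i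
          (λ j≤i → coeff p (ℕₚ.≤-<-trans j≤i i<N)) (λ j≤i → coeff q (ℕₚ.≤-<-trans j≤i i<N))
      ; *-assoc = λ f g h → exactly (⊛-assoc f g h)
      ; *-identity = (λ f → exactly (⊛-identityˡ f))
                   , (λ f → exactly λ i → trans (⊛-comm f _ i) (⊛-identityˡ f i))
      ; distrib = (λ f g h → exactly λ i → trans (⊛-comm f _ i) (trans (⊛-distribʳ f g h i)
                    (cong₂ ℤ._+_ (⊛-comm g f i) (⊛-comm h f i))))
                , (λ f g h → exactly (⊛-distribʳ f g h))
      }
    ; *-comm = λ f g → exactly (⊛-comm f g)
    }
  }
  where
  identityˡ : ∀ f i → (const 0ℤ ⊕ f) i ≡ f i
  identityˡ f i = trans (cong (ℤ._+ f i) (const-0 i)) (ℤₚ.+-identityˡ (f i))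

  inverseˡ : ∀ f i → (⊖ f ⊕ f) i ≡ const 0ℤ i
  inverseˡ f i = trans (ℤₚ.+-inverseˡ (f i)) (sym (const-0 i))

  ⊛-identityˡ : ∀ f i → (const 1ℤ ⊛ f) i ≡ f i
  ⊛-identityˡ f i = trans (const-⊛ 1ℤ f i) (ℤₚ.*-identityˡ (f i))

-- Integers embedded as constant series serve as coefficients for the ring solver, so that numerical
-- constants are computed in ℤ.
constMorphism : ∀ N → CommutativeRing.rawRing ℤₚ.+-*-commutativeRing
                  -Raw-AlmostCommutative⟶ fromCommutativeRing (seriesRing N)
constMorphism N = record
  { ⟦_⟧    = const
  ; +-homo = λ _ _ → exactly λ { zero → refl ; (suc _) → refl }
  ; *-homo = λ a b → exactly λ { zero → refl ; (suc i) →
      sym (trans (const-⊛ a (const b) (suc i)) (ℤₚ.*-zeroʳ a)) }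
  ; -‿homo = λ _ → exactly λ { zero → refl ; (suc _) → refl }
  ; 0-homo = exactly λ _ → refl
  ; 1-homo = exactly λ _ → refl
  }

private
  coefficient≟ : ∀ {N} (a b : ℤ) → Maybe (const a ≈[ N ] const b)
  coefficient≟ a b with a ℤ.≟ b
  ... | yes refl = just (exactly λ _ → refl)
  ... | no  _    = nothing

module SeriesSolver (N : ℕ) = Algebra.Solver.Ring
  (CommutativeRing.rawRing ℤₚ.+-*-commutativeRing) (fromCommutativeRing (seriesRing N))
  (constMorphism N) coefficient≟

-- A constant term 1 lets the coefficients of the right factor be recovered one after another. By
-- `⊛-suc` the factor `f` stays fixed while `g` and `h` pass to their tails.
⊛-cancelˡ : ∀ {N f g h} → f 0 ≡ 1ℤ → f ⊛ g ≈[ N ] f ⊛ h → g ≈[ N ] h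
⊛-cancelˡ {f = f} f₀≡1 p = below (go _ _ _ (coeff p))
  where
  ⊛-head : ∀ g → (f ⊛ g) 0 ≡ g 0
  ⊛-head g = trans (cong (_* g 0) f₀≡1) (ℤₚ.*-identityˡ (g 0))

  go : ∀ N g h → (∀ {i} → i ℕ.< N → (f ⊛ g) i ≡ (f ⊛ h) i) → ∀ {i} → i ℕ.< N → g i ≡ h i
  go (suc N) g h eq {zero}  _          = trans (sym (⊛-head g)) (trans (eq (s≤s z≤n)) (⊛-head h))
  go (suc N) g h eq {suc i} (s≤s i<N) = go N (tail g) (tail h) (λ {j} j<N →
    +-cancelˡ (f (suc j) * g 0) _ _ (begin
      f (suc j) * g 0 ℤ.+ (f ⊛ tail g) j ≡⟨ ⊛-suc f g j ⟨
      (f ⊛ g) (suc j)                    ≡⟨ eq (s≤s j<N) ⟩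
      (f ⊛ h) (suc j)                    ≡⟨ ⊛-suc f h j ⟩
      f (suc j) * h 0 ℤ.+ (f ⊛ tail h) j
        -- The constant terms of `g` and `h` already agree, which gives both sides the common
        -- summand to be cancelled.
        ≡⟨ cong (λ z → f (suc j) * z ℤ.+ (f ⊛ tail h) j) (sym (go (suc N) g h eq {0} (s≤s z≤n))) ⟩
      f (suc j) * g 0 ℤ.+ (f ⊛ tail h) j ∎)) i<N
    where open ≡-Reasoning
          open Algebra.Properties.Group (CommutativeRing.+-group ℤₚ.+-*-commutativeRing)
            renaming (∙-cancelˡ to +-cancelˡ)

θ-cong : ∀ {N f g} → f ≈[ N ] g → θ f ≈[ N ] θ g
θ-cong p = below λ {i} i<N → cong (+ i *_) (coeff p i<N)

∑ ∏ : ℕ → (ℕ → Series) → Series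
∑ zero    f = const 0ℤ
∑ (suc n) f = ∑ n f ⊕ f n
∏ zero    f = const 1ℤ
∏ (suc n) f = ∏ n f ⊛ f n

q : Series
q zero    = 0ℤ
q (suc i) = const 1ℤ i

q-⊛-suc : ∀ f i → (q ⊛ f) (suc i) ≡ f i
q-⊛-suc f i = trans (ℤₚ.+-identityˡ _) (trans (const-⊛ 1ℤ f i) (ℤₚ.*-identityˡ (f i)))

-- Lambert series and divisor sums

-- lambert d = Σ_{k≥1} d qᵈᵏ
lambert : ℕ → Series
lambert d zero    = 0ℤ
lambert d (suc i) = if does (d ∣? suc i) then + d else 0ℤ

if-∣-cong : ∀ {d d′ i i′} {x y : ℤ} → (d ∣ i → d′ ∣ i′) → (d′ ∣ i′ → d ∣ i) →
            (if does (d ∣? i) then x else y) ≡ (if does (d′ ∣? i′) then x else y)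
if-∣-cong {d} {d′} {i} {i′} {x} {y} to from =
  cong (λ b → if b then x else y) (does-⇔ (mk⇔ to from) (d ∣? i) (d′ ∣? i′))

lambert-∤ : ∀ {d i} → ¬ d ∣ suc i → lambert d (suc i) ≡ 0ℤ
lambert-∤ {d} {i} d∤i = cong (λ b → if b then + d else 0ℤ) (dec-false (d ∣? suc i) d∤i)

lambert-< : ∀ {d} i → i ℕ.< d → lambert d i ≡ 0ℤ
lambert-< zero    _   = refl
lambert-< (suc i) i<d = lambert-∤ (>⇒∤ i<d)

-- Divisibility by d has period d. The constant d repairs index 0, where `lambert` is 0 although d
-- divides 0.
lambert-+ : ∀ m i → lambert (suc m) (suc m ℕ.+ i) ≡ lambert (suc m) i ℤ.+ const (+ suc m) i
lambert-+ m zero = trans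
  (cong (λ b → if b then + suc m else 0ℤ)
    (dec-true (suc m ∣? suc (m ℕ.+ 0)) (∣-reflexive (cong suc (sym (ℕₚ.+-identityʳ m))))))
  (sym (ℤₚ.+-identityˡ _))
lambert-+ m (suc i) = trans
  (if-∣-cong {suc m} {suc m} (λ d∣ → ∣m+n∣m⇒∣n d∣ ∣-refl) (∣m∣n⇒∣m+n ∣-refl))
  (sym (ℤₚ.+-identityʳ _))

-- The constant term is set to 0, as for a logarithmic derivative; with `σ 0` equal to 1 the general
-- formula would give 1 - 4 = -3 there.
σ-series : Series
σ-series zero    = 0ℤ
σ-series (suc i) = + σ (suc i) - + 4 * + σHalf (suc i)

oddLambert evenLambert : ℕ → Series
oddLambert  s = lambert (suc (s ℕ.+ s))
evenLambert s = lambert (suc (suc (s ℕ.+ s)))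

∑-zero : ∀ {f i} n → (∀ s → f s i ≡ 0ℤ) → ∑ n f i ≡ 0ℤ
∑-zero {i = i} zero    _ = const-0 i
∑-zero {i = i} (suc n) p = cong₂ ℤ._+_ (∑-zero n p) (p n)

∑-lambert-sum : ∀ n j →
  ∑ n (λ d → lambert (suc d)) (suc j) ≡ + sum (filter (_∣? suc j) (map suc (upTo n)))
∑-lambert-sum zero    j = refl
∑-lambert-sum (suc n) j = begin
  ∑ n (λ d → lambert (suc d)) (suc j) ℤ.+ lambert (suc n) (suc j)
    ≡⟨ cong₂ ℤ._+_ (∑-lambert-sum n j) (sym (singleton (suc n))) ⟩
  + (sum (filter P? (map suc (upTo n))) ℕ.+ sum (filter P? [ suc n ]))
    ≡⟨ cong +_ (sum-++ (filter P? (map suc (upTo n))) _) ⟨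
  + sum (filter P? (map suc (upTo n)) ++ filter P? [ suc n ])
    ≡⟨ cong (λ l → + sum l) (filter-++ P? (map suc (upTo n)) _) ⟨
  + sum (filter P? (map suc (upTo n) ++ [ suc n ]))
    ≡⟨ cong (λ l → + sum (filter P? l)) (map-++ suc (upTo n) [ n ]) ⟨
  + sum (filter P? (map suc (upTo n ++ [ n ])))
    ≡⟨ cong (λ l → + sum (filter P? (map suc l))) (upTo-∷ʳ n) ⟩
  + sum (filter P? (map suc (upTo (suc n)))) ∎
  where
  open ≡-Reasoning
  P? = _∣? suc j
  singleton : ∀ d → + sum (filter P? [ d ]) ≡ lambert d (suc j)
  singleton d with does (d ∣? suc j)
  ... | true  = cong +_ (ℕₚ.+-identityʳ d)
  ... | false = refl

-- No d larger than the index divides it, so lengthening the sum past the index adds only zeros.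
∑-lambert : ∀ k j → ∑ (k ℕ.+ suc j) (λ d → lambert (suc d)) (suc j) ≡ + σ (suc j)
∑-lambert zero    j = ∑-lambert-sum (suc j) j
∑-lambert (suc k) j = trans
  (cong₂ ℤ._+_ (∑-lambert k j) (lambert-< (suc j) (s≤s (ℕₚ.m≤n+m (suc j) k))))
  (ℤₚ.+-identityʳ _)

∑-lambert-≤ : ∀ {n j} → suc j ℕ.≤ n → ∑ n (λ d → lambert (suc d)) (suc j) ≡ + σ (suc j)
∑-lambert-≤ {n} {j} j<n = subst (λ m → ∑ m (λ d → lambert (suc d)) (suc j) ≡ + σ (suc j))
  (ℕₚ.m∸n+n≡m j<n) (∑-lambert (n ∸ suc j) j)

∑-odd-even : ∀ n i →
  ∑ (n ℕ.+ n) (λ d → lambert (suc d)) i ≡ (∑ n oddLambert ⊕ ∑ n evenLambert) i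
∑-odd-even zero    i = sym (trans (cong (λ z → const 0ℤ i ℤ.+ z) (const-0 i)) (ℤₚ.+-identityʳ _))
∑-odd-even (suc n) i rewrite ℕₚ.+-suc n n | ∑-odd-even n i =
  solve 4 (λ a b c d → a :+ b :+ c :+ d := a :+ c :+ (b :+ d)) refl
    (∑ n oddLambert i) (∑ n evenLambert i) (oddLambert n i) (evenLambert n i)
  where open +-*-Solver

data Parity : ℕ → Set where
  twice    : ∀ h → Parity (h ℕ.* 2)
  1+twice  : ∀ h → Parity (suc (h ℕ.* 2))

parity : ∀ n → Parity n
parity zero = twice 0
parity (suc n) with parity n
... | twice h   = 1+twice h
... | 1+twice h = twice (suc h)

σHalf-even : ∀ h → σHalf (h ℕ.* 2) ≡ σ h
σHalf-even h = trans
  (cong (λ r → if ⌊ r ℕ.≟ 0 ⌋ then σ (h ℕ.* 2 ℕ./ 2) else 0) (m*n%n≡0 h 2))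
  (cong σ (m*n/n≡m h 2))

σHalf-odd : ∀ h → σHalf (suc (h ℕ.* 2)) ≡ 0
σHalf-odd h = cong (λ r → if ⌊ r ℕ.≟ 0 ⌋ then σ (suc (h ℕ.* 2) ℕ./ 2) else 0)
                   ([m+kn]%n≡m%n 1 h 2)

evenLambert≡ : ∀ s → evenLambert s ≡ lambert (suc s ℕ.* 2)
evenLambert≡ s = cong (λ d → lambert (suc (suc d)))
  (trans (cong (s ℕ.+_) (sym (ℕₚ.+-identityʳ s))) (ℕₚ.*-comm 2 s))

-- 2d divides 2i exactly when d divides i, and it then contributes 2d instead of d.
∑-evenLambert : ∀ n h →
  ∑ n evenLambert (suc h ℕ.* 2) ≡ + 2 * ∑ n (λ d → lambert (suc d)) (suc h)
∑-evenLambert zero    h = refl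
∑-evenLambert (suc n) h = trans
  (cong₂ ℤ._+_ (∑-evenLambert n h) double)
  (sym (ℤₚ.*-distribˡ-+ (+ 2) (∑ n (λ d → lambert (suc d)) (suc h)) (lambert (suc n) (suc h))))
  where
  double : evenLambert n (suc h ℕ.* 2) ≡ + 2 * lambert (suc n) (suc h)
  double = begin
    evenLambert n (suc h ℕ.* 2)
      ≡⟨ cong (λ l → l (suc h ℕ.* 2)) (evenLambert≡ n) ⟩
    (if does (suc n ℕ.* 2 ∣? suc h ℕ.* 2) then + (suc n ℕ.* 2) else 0ℤ)
      ≡⟨ if-∣-cong {suc n ℕ.* 2} {suc n} {suc h ℕ.* 2} {suc h} (*-cancelʳ-∣ 2) (*-monoˡ-∣ 2) ⟩
    (if does (suc n ∣? suc h) then + (suc n ℕ.* 2) else 0ℤ)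
      ≡⟨ cong (λ d → if does (suc n ∣? suc h) then + d else 0ℤ) (ℕₚ.*-comm (suc n) 2) ⟩
    (if does (suc n ∣? suc h) then + (2 ℕ.* suc n) else 0ℤ)
      ≡⟨ pull (does (suc n ∣? suc h)) ⟩
    + 2 * lambert (suc n) (suc h) ∎
    where
    open ≡-Reasoning
    pull : ∀ b → (if b then + (2 ℕ.* suc n) else 0ℤ) ≡ + 2 * (if b then + suc n else 0ℤ)
    pull true  = refl
    pull false = refl

∑-evenLambert-σHalf : ∀ {n i} → suc i ℕ.≤ n → ∑ n evenLambert (suc i) ≡ + 2 * + σHalf (suc i)
∑-evenLambert-σHalf {n} {i} i<n with parity i
-- The index is `suc i`, so an even `i` means an odd index, which has no even divisor.
... | twice h = trans
  (∑-zero {evenLambert} n λ s → trans (cong (λ l → l (suc (h ℕ.* 2))) (evenLambert≡ s))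
    (lambert-∤ (λ d∣ → 2∤odd h (∣-trans (divides (suc s) refl) d∣))))
  (cong (λ m → + 2 * + m) (sym (σHalf-odd h)))
  where
  2∤odd : ∀ h → ¬ 2 ∣ suc (h ℕ.* 2)
  2∤odd h 2∣ with ∣m+n∣m⇒∣n (subst (2 ∣_) (ℕₚ.+-comm 1 (h ℕ.* 2)) 2∣) (divides h refl)
  ... | 2∣1 = >⇒∤ ℕₚ.≤-refl 2∣1
... | 1+twice h = begin
  ∑ n evenLambert (suc h ℕ.* 2)
    ≡⟨ ∑-evenLambert n h ⟩
  + 2 * ∑ n (λ d → lambert (suc d)) (suc h)
    ≡⟨ cong (+ 2 *_) (∑-lambert-≤ (ℕₚ.≤-trans (ℕₚ.m≤m*n (suc h) 2) i<n)) ⟩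
  + 2 * + σ (suc h)
    ≡⟨ cong (λ m → + 2 * + m) (σHalf-even (suc h)) ⟨
  + 2 * + σHalf (suc h ℕ.* 2) ∎
  where open ≡-Reasoning

-- For a positive index, with O and E the sums of its odd and even divisors, O - E = (O + E) - 2E;
-- here O + E is σ and E is twice σ of half the index.
odd-even-lambert : ∀ n i → i ℕ.≤ n → (∑ n oddLambert ⊕ ⊖ ∑ n evenLambert) i ≡ σ-series i
odd-even-lambert n zero    _   =
  cong₂ _-_ (∑-zero {oddLambert} n (λ _ → refl)) (∑-zero {evenLambert} n (λ _ → refl))
odd-even-lambert n (suc i) i<n = begin
  o - e                                    ≡⟨ solve 2 (λ o e → o :- e := o :+ e :- con (+ 2) :* e) refl o e ⟩
  o ℤ.+ e - + 2 * e                        ≡⟨ cong (_- + 2 * e) (∑-odd-even n (suc i)) ⟨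
  ∑ (n ℕ.+ n) (λ d → lambert (suc d)) (suc i) - + 2 * e
    ≡⟨ cong₂ (λ a b → a - + 2 * b) (∑-lambert-≤ (ℕₚ.≤-trans i<n (ℕₚ.m≤m+n n n)))
         (∑-evenLambert-σHalf i<n) ⟩
  + σ (suc i) - + 2 * (+ 2 * + σHalf (suc i))
    ≡⟨ cong (+ σ (suc i) -_) (ℤₚ.*-assoc (+ 2) (+ 2) (+ σHalf (suc i))) ⟨
  + σ (suc i) - + 4 * + σHalf (suc i) ∎
  where
  open ≡-Reasoning
  open +-*-Solver
  o e : ℤ
  o = ∑ n oddLambert (suc i)
  e = ∑ n evenLambert (suc i)

-- Counting representations

-- The generating function Σ q^(sumTri v) over the list. Concatenation becomes addition, and
-- prepending an entry x to every vector becomes multiplication by q^tri(x).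
counts : ∀ {k} → List (Vec ℕ k) → Series
counts vs i = + length (filter (λ v → i ℕ.≟ sumTri v) vs)

t-series : ℕ → Series
t-series k i = + t k i

counts-++ : ∀ {k} (vs ws : List (Vec ℕ k)) i → counts (vs ++ ws) i ≡ (counts vs ⊕ counts ws) i
counts-++ vs ws i = cong +_ (trans (cong length (filter-++ (λ v → i ℕ.≟ sumTri v) vs ws))
                                   (length-++ (filter (λ v → i ℕ.≟ sumTri v) vs)))

counts-cons-< : ∀ {k x i} → i ℕ.< tri x → (vs : List (Vec ℕ k)) →
  length (filter (λ v → i ℕ.≟ sumTri v) (map (x ∷_) vs)) ≡ 0
counts-cons-< i<x []       = refl
counts-cons-< {x = x} {i} i<x (v ∷ vs)
  rewrite dec-false (i ℕ.≟ tri x ℕ.+ sumTri v)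
            (λ eq → ℕₚ.<⇒≱ i<x (ℕₚ.≤-trans (ℕₚ.m≤m+n _ _) (ℕₚ.≤-reflexive (sym eq))))
  = counts-cons-< i<x vs

counts-cons-+ : ∀ {k} x o (vs : List (Vec ℕ k)) →
  length (filter (λ v → tri x ℕ.+ o ℕ.≟ sumTri v) (map (x ∷_) vs))
    ≡ length (filter (λ v → o ℕ.≟ sumTri v) vs)
counts-cons-+ x o []       = refl
counts-cons-+ x o (v ∷ vs)
  rewrite does-⇔ (mk⇔ (ℕₚ.+-cancelˡ-≡ (tri x) o (sumTri v)) (cong (tri x ℕ.+_)))
            (tri x ℕ.+ o ℕ.≟ tri x ℕ.+ sumTri v) (o ℕ.≟ sumTri v)
  with does (o ℕ.≟ sumTri v)
... | true  = cong suc (counts-cons-+ x o vs)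
... | false = counts-cons-+ x o vs

-- Triangular numbers

tri-suc : ∀ x → tri (suc x) ≡ suc x ℕ.+ tri x
tri-suc x = begin
  (suc x ℕ.* suc (suc x)) ℕ./ 2
    ≡⟨ cong (ℕ._/ 2) (solve 1 (λ x → (con 1 :+ x) :* (con 2 :+ x)
                                 := (con 1 :+ x) :* con 2 :+ x :* (con 1 :+ x)) refl x) ⟩
  (suc x ℕ.* 2 ℕ.+ x ℕ.* suc x) ℕ./ 2
    ≡⟨ +-distrib-/-∣ˡ {suc x ℕ.* 2} (x ℕ.* suc x) (divides (suc x) refl) ⟩
  (suc x ℕ.* 2) ℕ./ 2 ℕ.+ tri x
    ≡⟨ cong (ℕ._+ tri x) (m*n/n≡m (suc x) 2) ⟩
  suc x ℕ.+ tri x ∎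
  where open ≡-Reasoning
        open ℕ-Solver

tri-double : ∀ n → tri (n ℕ.+ n) ≡ suc (n ℕ.+ n) ℕ.* n
tri-double n = trans
  (cong (ℕ._/ 2) (solve 1 (λ n → (n :+ n) :* (con 1 :+ (n :+ n))
                                 := (con 1 :+ (n :+ n)) :* n :* con 2) refl n))
  (m*n/n≡m (suc (n ℕ.+ n) ℕ.* n) 2)
  where open ℕ-Solver

x≤tri[x] : ∀ x → x ℕ.≤ tri x
x≤tri[x] zero    = z≤n
x≤tri[x] (suc x) = ℕₚ.≤-trans (ℕₚ.m≤m+n (suc x) (tri x)) (ℕₚ.≤-reflexive (sym (tri-suc x)))

-- Identities modulo q^N

module Truncated (N : ℕ) where

  open CommutativeRing (seriesRing N) using (_≈_; setoid; commutativeSemiring;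
    +-cong; +-congˡ; +-congʳ; *-cong; *-congˡ; *-congʳ; *-assoc;
    *-identityˡ; *-identityʳ; +-identityˡ; +-identityʳ; zeroˡ; -‿cong)
    renaming (refl to ≈-refl; sym to ≈-sym; trans to ≈-trans; reflexive to ≈-reflexive)
  open Algebra.Properties.CommutativeSemiring.Exp commutativeSemiring
  open SeriesSolver N
  open Relation.Binary.Reasoning.Setoid setoid

  -- Shanks's finite identity

  p : Series
  p = q ⊛ q

  -- These are q²ⁿ⁺¹, 1 - q²ⁿ⁺¹ and 1 - q²ⁿ⁺². Writing them through q and powers of p = q² lets the
  -- ring solver treat pⁿ as an indeterminate.
  y odd even : ℕ → Series
  y n    = q ⊛ p ^ n
  odd n  = const 1ℤ ⊕ ⊖ y n
  even n = const 1ℤ ⊕ ⊖ (p ^ suc n)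

  -- C r s = (1 − q)(1 − q³)⋯(1 − q²ˢ⁻¹) · (1 − q²ˢ⁺²)⋯(1 − q²⁽ˢ⁺ʳ⁾)
  C : ℕ → ℕ → Series
  C zero    s = ∏ s odd
  C (suc r) s = C r s ⊛ even (s ℕ.+ r)

  -- Both sides are the product of all `odd i` with i ≤ s and all `even i` with s ≤ i ≤ s + r.
  C-shift : ∀ r s → C (suc r) s ⊛ odd s ≈ C r (suc s) ⊛ even s
  C-shift zero    s = begin
    ∏ s odd ⊛ even (s ℕ.+ 0) ⊛ odd s
      ≈⟨ solve 3 (λ a b c → a :* b :* c := a :* c :* b) ≈-refl
           (∏ s odd) (even (s ℕ.+ 0)) (odd s) ⟩
    ∏ s odd ⊛ odd s ⊛ even (s ℕ.+ 0)
      ≡⟨ cong (λ m → ∏ s odd ⊛ odd s ⊛ even m) (ℕₚ.+-identityʳ s) ⟩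
    ∏ s odd ⊛ odd s ⊛ even s ∎
  C-shift (suc r) s = begin
    C (suc r) s ⊛ even (s ℕ.+ suc r) ⊛ odd s
      ≈⟨ solve 3 (λ a b c → a :* b :* c := a :* c :* b) ≈-refl
           (C (suc r) s) (even (s ℕ.+ suc r)) (odd s) ⟩
    C (suc r) s ⊛ odd s ⊛ even (s ℕ.+ suc r)
      ≈⟨ *-congʳ (C-shift r s) ⟩
    C r (suc s) ⊛ even s ⊛ even (s ℕ.+ suc r)
      ≡⟨ cong (λ m → C r (suc s) ⊛ even s ⊛ even m) (ℕₚ.+-suc s r) ⟩
    C r (suc s) ⊛ even s ⊛ even (suc s ℕ.+ r)
      ≈⟨ solve 3 (λ a b c → a :* b :* c := a :* c :* b) ≈-refl
           (C r (suc s)) (even s) (even (suc s ℕ.+ r)) ⟩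
    C r (suc s) ⊛ even (suc s ℕ.+ r) ⊛ even s ∎

  -- The first m terms of Shanks's sum; D-step telescopes Dₙ₊₁ − (1 − q²ⁿ⁺¹) Dₙ.
  D : ℕ → ℕ → Series
  D n m = ∑ m (λ s → y n ^ s ⊛ C (n ∸ s) s)

  y-suc-^ : ∀ n s → y (suc n) ^ s ≈ y n ^ s ⊛ p ^ s
  y-suc-^ n s = ≈-trans
    (^-congˡ s (solve 3 (λ q p pⁿ → q :* (p :* pⁿ) := q :* pⁿ :* p) ≈-refl q p (p ^ n)))
    (^-distrib-* (y n) p s)

  D-step : ∀ n m → m ℕ.≤ n →
    D (suc n) m ≈ odd n ⊛ D n m ⊕ y n ^ m ⊛ C (n ∸ m) m ⊛ (const 1ℤ ⊕ ⊖ (p ^ m))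
  D-step n zero    _   =
    solve 3 (λ o c y → con 0ℤ := o :* con 0ℤ :+ con 1ℤ :* c :* (con 1ℤ :- con 1ℤ)) ≈-refl
      (odd n) (C n 0) (y n)
  D-step n (suc m) m<n = begin
    D (suc n) m ⊕ y (suc n) ^ m ⊛ C (suc n ∸ m) m
      ≈⟨ +-cong (D-step n m (ℕₚ.<⇒≤ m<n)) (*-cong (y-suc-^ n m) (≈-reflexive C-suc)) ⟩
    odd n ⊛ S ⊕ Y ⊛ c ⊛ (const 1ℤ ⊕ ⊖ a) ⊕ Y ⊛ a ⊛ (c ⊛ even n)
      -- The identity used is 1 - a + a(1 - q²pⁿ) = (1 - qpⁿ) + qpⁿ(1 - qa). The first part extends
      -- the sum multiplied by `odd n`; the second becomes the next remainder.
      ≈⟨ solve 6 (λ q pⁿ S Y c a →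
           (con 1ℤ :- q :* pⁿ) :* S :+ Y :* c :* (con 1ℤ :- a)
             :+ Y :* a :* (c :* (con 1ℤ :- q :* q :* pⁿ))
             := (con 1ℤ :- q :* pⁿ) :* (S :+ Y :* c) :+ q :* pⁿ :* Y :* (c :* (con 1ℤ :- q :* a)))
           ≈-refl q (p ^ n) S Y c a ⟩
    odd n ⊛ (S ⊕ Y ⊛ c) ⊕ y n ⊛ Y ⊛ (c ⊛ odd m)
      -- Trading `odd m` for `even m`, which is 1 - pᵐ⁺¹, gives the remainder the required form at m
      -- + 1.
      ≈⟨ +-congˡ {odd n ⊛ (S ⊕ Y ⊛ c)} (*-congˡ {y n ⊛ Y} c-shift) ⟩
    odd n ⊛ (S ⊕ Y ⊛ c) ⊕ y n ⊛ Y ⊛ (C (n ∸ suc m) (suc m) ⊛ even m)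
      ≈⟨ +-congˡ {odd n ⊛ D n (suc m)} (*-assoc (y n ^ suc m) _ _) ⟨
    odd n ⊛ D n (suc m) ⊕ y n ^ suc m ⊛ C (n ∸ suc m) (suc m) ⊛ even m ∎
    where
    S Y c a : Series
    S = D n m
    Y = y n ^ m
    c = C (n ∸ m) m
    a = p ^ m

    m≤n : m ℕ.≤ n
    m≤n = ℕₚ.<⇒≤ m<n

    C-suc : C (suc n ∸ m) m ≡ c ⊛ even n
    C-suc = trans (cong (λ r → C r m) (ℕₚ.+-∸-assoc 1 m≤n))
                  (cong (λ r → c ⊛ even r) (ℕₚ.m+[n∸m]≡n m≤n))

    c-shift : c ⊛ odd m ≈ C (n ∸ suc m) (suc m) ⊛ even m
    c-shift = ≈-trans (*-congʳ (≈-reflexive (cong (λ r → C r m) (ℕₚ.+-∸-assoc 1 m<n))))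
                      (C-shift (n ∸ suc m) m)

  y≈q^ : ∀ n → y n ≈ q ^ suc (n ℕ.+ n)
  y≈q^ n = *-congˡ (≈-trans (^-distrib-* q q n) (≈-sym (^-homo-* q n n)))

  ψ : ℕ → Series
  ψ n = ∑ n (λ i → q ^ tri i)

  -- The terms of ψ with indices 2n and 2n + 1 are consecutive powers of q²ⁿ⁺¹, the form in which
  -- they arise in `gauss`.
  q^tri-even : ∀ n → q ^ tri (n ℕ.+ n) ≈ y n ^ n
  q^tri-even n = begin
    q ^ tri (n ℕ.+ n)           ≡⟨ cong (q ^_) (tri-double n) ⟩
    q ^ (suc (n ℕ.+ n) ℕ.* n)   ≈⟨ ^-assocʳ q (suc (n ℕ.+ n)) n ⟨
    (q ^ suc (n ℕ.+ n)) ^ n     ≈⟨ ^-congˡ n (y≈q^ n) ⟨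
    y n ^ n ∎

  q^tri-odd : ∀ n → q ^ tri (suc (n ℕ.+ n)) ≈ y n ^ suc n
  q^tri-odd n = begin
    q ^ tri (suc (n ℕ.+ n))                     ≡⟨ cong (q ^_) (tri-suc (n ℕ.+ n)) ⟩
    q ^ (suc (n ℕ.+ n) ℕ.+ tri (n ℕ.+ n))       ≈⟨ ^-homo-* q (suc (n ℕ.+ n)) (tri (n ℕ.+ n)) ⟩
    q ^ suc (n ℕ.+ n) ⊛ q ^ tri (n ℕ.+ n)       ≈⟨ *-cong (≈-sym (y≈q^ n)) (q^tri-even n) ⟩
    y n ⊛ y n ^ n ∎

  -- The induction step is `D-step` at m = n, whose remainder is merged with the new last term of
  -- the sum.
  gauss : ∀ n → D n n ≈ ∏ n odd ⊛ ψ (n ℕ.+ n)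
  gauss zero    = ≈-sym (*-identityˡ _)
  gauss (suc n) = begin
    D (suc n) n ⊕ y (suc n) ^ n ⊛ C (suc n ∸ n) n
      ≈⟨ +-cong (D-step n n ℕₚ.≤-refl) (*-cong (y-suc-^ n n) (≈-reflexive C-one)) ⟩
    odd n ⊛ D n n ⊕ y n ^ n ⊛ C (n ∸ n) n ⊛ (const 1ℤ ⊕ ⊖ (p ^ n))
      ⊕ y n ^ n ⊛ p ^ n ⊛ (b ⊛ even n)
      ≈⟨ +-congʳ (+-cong (*-congˡ (gauss n))
           (*-congʳ (*-congˡ (≈-reflexive (cong (λ r → C r n) (ℕₚ.n∸n≡0 n)))))) ⟩
    odd n ⊛ (b ⊛ ψ (n ℕ.+ n)) ⊕ y n ^ n ⊛ b ⊛ (const 1ℤ ⊕ ⊖ (p ^ n))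
      ⊕ y n ^ n ⊛ p ^ n ⊛ (b ⊛ even n)
      -- Remainder and last term combine by 1 - a + a(1 - q²a) = (1 - qa)(1 + qa), where qa is
      -- `y n`. So `odd n` factors out and leaves the two new terms Y and qaY of ψ.
      ≈⟨ solve 5 (λ q a b ψ Y →
           (con 1ℤ :- q :* a) :* (b :* ψ) :+ Y :* b :* (con 1ℤ :- a)
             :+ Y :* a :* (b :* (con 1ℤ :- q :* q :* a))
             := b :* (con 1ℤ :- q :* a) :* (ψ :+ Y :+ q :* a :* Y))
           ≈-refl q (p ^ n) b (ψ (n ℕ.+ n)) (y n ^ n) ⟩
    b ⊛ odd n ⊛ (ψ (n ℕ.+ n) ⊕ y n ^ n ⊕ y n ^ suc n)
      ≈⟨ *-congˡ (+-cong (+-congˡ {ψ (n ℕ.+ n)} (q^tri-even n)) (q^tri-odd n)) ⟨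
    b ⊛ odd n ⊛ ψ (suc (suc (n ℕ.+ n)))
      ≡⟨ cong (λ m → b ⊛ odd n ⊛ ψ (suc m)) (ℕₚ.+-suc n n) ⟨
    b ⊛ odd n ⊛ ψ (suc n ℕ.+ suc n) ∎
    where
    b : Series
    b = ∏ n odd

    C-one : C (suc n ∸ n) n ≡ b ⊛ even n
    C-one = trans (cong (λ r → C r n) (ℕₚ.m+n∸n≡m 1 n))
                  (cong (λ r → b ⊛ even r) (ℕₚ.+-identityʳ n))

  -- Powers of q as shifts, and Gauss's product modulo q^N

  q^-⊛-+ : ∀ m f i → (q ^ m ⊛ f) (m ℕ.+ i) ≡ f i
  q^-⊛-+ zero    f i = trans (const-⊛ 1ℤ f i) (ℤₚ.*-identityˡ (f i))
  q^-⊛-+ (suc m) f i = trans (⊛-assoc q (q ^ m) f (suc (m ℕ.+ i)))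
    (trans (q-⊛-suc (q ^ m ⊛ f) (m ℕ.+ i)) (q^-⊛-+ m f i))

  q^-⊛-< : ∀ m f {i} → i ℕ.< m → (q ^ m ⊛ f) i ≡ 0ℤ
  q^-⊛-< (suc m) f {zero}  _         = ⊛-assoc q (q ^ m) f 0
  q^-⊛-< (suc m) f {suc i} (s≤s i<m) = trans (⊛-assoc q (q ^ m) f (suc i))
    (trans (q-⊛-suc (q ^ m ⊛ f) i) (q^-⊛-< m f i<m))

  q^≈0 : ∀ {m} → N ℕ.≤ m → q ^ m ≈ const 0ℤ
  q^≈0 {m} N≤m = ≈-trans (≈-sym (*-identityʳ (q ^ m)))
    (below λ {i} i<N → trans (q^-⊛-< m (const 1ℤ) (ℕₚ.<-≤-trans i<N N≤m)) (sym (const-0 i)))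

  -- The added terms have exponents tri(i) ≥ i ≥ N.
  ψ-stable : ∀ k → ψ (k ℕ.+ N) ≈ ψ N
  ψ-stable zero    = ≈-refl
  ψ-stable (suc k) = ≈-trans
    (+-cong (ψ-stable k) (q^≈0 (ℕₚ.≤-trans (ℕₚ.m≤n+m N k) (x≤tri[x] (k ℕ.+ N)))))
    (+-identityʳ (ψ N))

  -- Every term with s > 0 contains the factor `y n`.
  D-leading : ∀ n m → y n ≈ const 0ℤ → D n (suc m) ≈ C n 0
  D-leading n zero    _    = ≈-trans (+-identityˡ (const 1ℤ ⊛ C n 0)) (*-identityˡ (C n 0))
  D-leading n (suc m) y≈0 = ≈-trans
    (+-cong (D-leading n m y≈0) (≈-trans
      (*-congʳ (≈-trans (*-congʳ y≈0) (zeroˡ (y n ^ m))))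
      (zeroˡ (C (n ∸ suc m) (suc m)))))
    (+-identityʳ (C n 0))

  C-zero : ∀ n → C n 0 ≡ ∏ n even
  C-zero zero    = refl
  C-zero (suc n) = cong (_⊛ even n) (C-zero n)

  gauss-truncated : ∏ N odd ⊛ ψ N ≈ ∏ N even
  gauss-truncated = begin
    ∏ N odd ⊛ ψ N           ≈⟨ *-congˡ (ψ-stable N) ⟨
    ∏ N odd ⊛ ψ (N ℕ.+ N)   ≈⟨ gauss N ⟨
    D N N                   ≈⟨ leading N ℕₚ.≤-refl ⟩
    C N 0                   ≡⟨ C-zero N ⟩
    ∏ N even                ∎
    where
    leading : ∀ n → N ℕ.≤ n → D n n ≈ C n 0
    -- `D 0 0` is 0 and `C 0 0` is 1, but n = 0 forces N = 0, where every congruence holds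
    -- vacuously.
    leading zero    z≤n = below λ ()
    leading (suc n) N≤n = D-leading (suc n) n
      (≈-trans (y≈q^ (suc n)) (q^≈0 (ℕₚ.≤-trans N≤n (ℕₚ.≤-trans (ℕₚ.m≤m+n _ _) (ℕₚ.n≤1+n _)))))

  -- Logarithmic derivatives without division

  θ-const : ∀ c → θ (const c) ≈ const 0ℤ
  θ-const c = exactly λ { zero → refl ; (suc i) → ℤₚ.*-zeroʳ (+ suc i) }

  θ-q^ : ∀ m → θ (q ^ m) ≈ const (+ m) ⊛ q ^ m
  θ-q^ zero    = ≈-trans (θ-const 1ℤ) (≈-sym (zeroˡ _))
  θ-q^ (suc m) = begin
    θ (q ⊛ q ^ m)
      ≈⟨ exactly (θ-⊛ q (q ^ m)) ⟩
    θ q ⊛ q ^ m ⊕ q ⊛ θ (q ^ m)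
      ≈⟨ +-cong (*-congʳ (exactly θ-q))
                (*-congˡ (θ-q^ m)) ⟩
    q ⊛ q ^ m ⊕ q ⊛ (const (+ m) ⊛ q ^ m)
      ≈⟨ solve 3 (λ q Q m → q :* Q :+ q :* (m :* Q) := (con 1ℤ :+ m) :* (q :* Q)) ≈-refl
           q (q ^ m) (const (+ m)) ⟩
    (const 1ℤ ⊕ const (+ m)) ⊛ (q ⊛ q ^ m)
      ≈⟨ *-congʳ (exactly {f = const 1ℤ ⊕ const (+ m)} λ { zero → refl ; (suc _) → refl }) ⟩
    const (+ suc m) ⊛ q ^ suc m ∎
    where
    θ-q : ∀ i → θ q i ≡ q i
    θ-q zero          = refl
    θ-q (suc zero)    = refl
    θ-q (suc (suc i)) = ℤₚ.*-zeroʳ (+ suc (suc i))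

  -- This stands in for the closed form d q^d / (1 - q^d), with the denominator cleared.
  lambert-recurrence : ∀ m → lambert (suc m) ≈ q ^ suc m ⊛ (lambert (suc m) ⊕ const (+ suc m))
  lambert-recurrence m = exactly go
    where
    f : Series
    f = lambert (suc m) ⊕ const (+ suc m)
    go : ∀ i → lambert (suc m) i ≡ (q ^ suc m ⊛ f) i
    go i with i ℕ.<? suc m
    ... | yes i<m = trans (lambert-< i i<m) (sym (q^-⊛-< (suc m) f i<m))
    ... | no  i≮m with ℕₚ.m≤n⇒∃[o]m+o≡n (ℕₚ.≮⇒≥ i≮m)
    ... | (o , refl) = trans (lambert-+ m o) (sym (q^-⊛-+ (suc m) f o))

  -- With d = m + 1, the left side is -d q^d, and the recurrence for the Lambert series L says d q^d
  -- = (1 - q^d) L.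
  θ-1-q^ : ∀ m → θ (const 1ℤ ⊕ ⊖ (q ^ suc m)) ≈ ⊖ ((const 1ℤ ⊕ ⊖ (q ^ suc m)) ⊛ lambert (suc m))
  θ-1-q^ m = begin
    θ (const 1ℤ ⊕ ⊖ Q)
      ≈⟨ exactly (λ i → trans (ℤₚ.*-distribˡ-+ (+ i) (const 1ℤ i) (ℤ.- Q i))
           (cong (λ z → θ (const 1ℤ) i ℤ.+ z) (sym (ℤₚ.neg-distribʳ-* (+ i) (Q i))))) ⟩
    θ (const 1ℤ) ⊕ ⊖ θ Q
      ≈⟨ +-cong (θ-const 1ℤ) (-‿cong (θ-q^ (suc m))) ⟩
    const 0ℤ ⊕ ⊖ (const (+ suc m) ⊛ Q)
      ≈⟨ solve 3 (λ m Q L → con 0ℤ :- m :* Q := :- (Q :* (L :+ m)) :+ Q :* L) ≈-refl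
           (const (+ suc m)) Q L ⟩
    ⊖ (Q ⊛ (L ⊕ const (+ suc m))) ⊕ Q ⊛ L
      ≈⟨ +-congʳ (-‿cong (lambert-recurrence m)) ⟨
    ⊖ L ⊕ Q ⊛ L
      ≈⟨ solve 2 (λ Q L → :- L :+ Q :* L := (:- ((con 1ℤ :- Q) :* L))) ≈-refl Q L ⟩
    ⊖ ((const 1ℤ ⊕ ⊖ Q) ⊛ L) ∎
    where
    Q L : Series
    Q = q ^ suc m
    L = lambert (suc m)

  -- Logarithmic derivatives of the factors add up, by the Leibniz rule.
  θ-∏ : ∀ {f l} n → (∀ s → θ (f s) ≈ ⊖ (f s ⊛ l s)) → θ (∏ n f) ≈ ⊖ (∏ n f ⊛ ∑ n l)
  θ-∏ zero    _ = ≈-trans (θ-const 1ℤ)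
    (solve 0 (con 0ℤ := :- (con 1ℤ :* con 0ℤ)) ≈-refl)
  θ-∏ {f} {l} (suc n) θf = begin
    θ (∏ n f ⊛ f n)
      ≈⟨ exactly (θ-⊛ (∏ n f) (f n)) ⟩
    θ (∏ n f) ⊛ f n ⊕ ∏ n f ⊛ θ (f n)
      ≈⟨ +-cong (*-congʳ (θ-∏ n θf)) (*-congˡ (θf n)) ⟩
    ⊖ (∏ n f ⊛ ∑ n l) ⊛ f n ⊕ ∏ n f ⊛ ⊖ (f n ⊛ l n)
      ≈⟨ solve 4 (λ P S f l → :- (P :* S) :* f :+ P :* (:- (f :* l)) := :- (P :* f :* (S :+ l))) ≈-refl
           (∏ n f) (∑ n l) (f n) (l n) ⟩
    ⊖ (∏ n f ⊛ f n ⊛ (∑ n l ⊕ l n)) ∎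

  1-cong : ∀ {f g} → f ≈ g → const 1ℤ ⊕ ⊖ f ≈ const 1ℤ ⊕ ⊖ g
  1-cong f≈g = +-congˡ {const 1ℤ} (-‿cong f≈g)

  θ-factor : ∀ {f} m → f ≈ q ^ suc m →
             θ (const 1ℤ ⊕ ⊖ f) ≈ ⊖ ((const 1ℤ ⊕ ⊖ f) ⊛ lambert (suc m))
  θ-factor m f≈q^ = ≈-trans (θ-cong (1-cong f≈q^))
    (≈-trans (θ-1-q^ m) (-‿cong (*-congʳ (1-cong (≈-sym f≈q^)))))

  p^≈q^ : ∀ s → p ^ suc s ≈ q ^ suc (suc (s ℕ.+ s))
  p^≈q^ s = ≈-trans (*-assoc q q (p ^ s)) (*-congˡ (y≈q^ s))

  -- Applying θ to B ψ = `∏ N even` gives -B O ψ + B θψ = -(B ψ) E, hence B θψ = B (O - E) ψ. The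
  -- product B has constant term 1 and cancels.
  θψ : θ (ψ N) ≈ σ-series ⊛ ψ N
  θψ = ⊛-cancelˡ (∏-odd-head N) (begin
    B ⊛ θ (ψ N)
      ≈⟨ solve 4 (λ B O θψ ψ → B :* θψ := :- (B :* O) :* ψ :+ B :* θψ :+ B :* O :* ψ) ≈-refl
           B O (θ (ψ N)) (ψ N) ⟩
    ⊖ (B ⊛ O) ⊛ ψ N ⊕ B ⊛ θ (ψ N) ⊕ B ⊛ O ⊛ ψ N
      ≈⟨ +-congʳ (+-congʳ (*-congʳ (θ-∏ N (λ s → θ-factor (s ℕ.+ s) (y≈q^ s))))) ⟨
    θ B ⊛ ψ N ⊕ B ⊛ θ (ψ N) ⊕ B ⊛ O ⊛ ψ N
      ≈⟨ +-congʳ (exactly (θ-⊛ B (ψ N))) ⟨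
    θ (B ⊛ ψ N) ⊕ B ⊛ O ⊛ ψ N
      ≈⟨ +-congʳ (θ-cong gauss-truncated) ⟩
    θ (∏ N even) ⊕ B ⊛ O ⊛ ψ N
      ≈⟨ +-congʳ (θ-∏ N (λ s → θ-factor (suc (s ℕ.+ s)) (p^≈q^ s))) ⟩
    ⊖ (∏ N even ⊛ E) ⊕ B ⊛ O ⊛ ψ N
      ≈⟨ +-congʳ (-‿cong (*-congʳ gauss-truncated)) ⟨
    ⊖ (B ⊛ ψ N ⊛ E) ⊕ B ⊛ O ⊛ ψ N
      ≈⟨ solve 4 (λ B ψ O E → :- (B :* ψ :* E) :+ B :* O :* ψ := B :* ((O :- E) :* ψ)) ≈-refl
           B (ψ N) O E ⟩
    B ⊛ ((O ⊕ ⊖ E) ⊛ ψ N)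
      ≈⟨ *-congˡ (*-congʳ (below λ {i} i<N → odd-even-lambert N i (ℕₚ.<⇒≤ i<N))) ⟩
    B ⊛ (σ-series ⊛ ψ N) ∎)
    where
    B O E : Series
    B = ∏ N odd
    O = ∑ N oddLambert
    E = ∑ N evenLambert

    ∏-odd-head : ∀ n → ∏ n odd 0 ≡ 1ℤ
    ∏-odd-head zero    = refl
    ∏-odd-head (suc n) = cong (_* odd n 0) (∏-odd-head n)

  -- Generating functions of the enumerated vectors

  counts-concatMap : ∀ {k} m (vs : List (Vec ℕ k)) →
    counts (concatMap (λ x → map (x ∷_) vs) (upTo m)) ≈ ψ m ⊛ counts vs
  counts-concatMap zero    vs = ≈-trans (exactly (λ i → sym (const-0 i))) (≈-sym (zeroˡ _))
  counts-concatMap (suc m) vs = begin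
    counts (concatMap F (upTo (suc m)))
      ≡⟨ cong (counts ∘ concatMap F) (sym (upTo-∷ʳ m)) ⟩
    counts (concatMap F (upTo m ++ [ m ]))
      ≡⟨ cong counts (trans (concatMap-++ F (upTo m) [ m ])
           (cong (concatMap F (upTo m) ++_) (++-identityʳ (F m)))) ⟩
    counts (concatMap F (upTo m) ++ F m)
      ≈⟨ exactly (counts-++ (concatMap F (upTo m)) (F m)) ⟩
    counts (concatMap F (upTo m)) ⊕ counts (F m)
      ≈⟨ +-cong (counts-concatMap m vs) (exactly (counts-cons m)) ⟩
    ψ m ⊛ counts vs ⊕ q ^ tri m ⊛ counts vs
      ≈⟨ exactly (⊛-distribʳ (counts vs) (ψ m) (q ^ tri m)) ⟨
    ψ (suc m) ⊛ counts vs ∎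
    where
    F : ℕ → List (Vec ℕ _)
    F x = map (x ∷_) vs

    counts-cons : ∀ x i → counts (F x) i ≡ (q ^ tri x ⊛ counts vs) i
    counts-cons x i with i ℕ.<? tri x
    ... | yes i<x = trans (cong +_ (counts-cons-< i<x vs)) (sym (q^-⊛-< (tri x) (counts vs) i<x))
    ... | no  i≮x with ℕₚ.m≤n⇒∃[o]m+o≡n (ℕₚ.≮⇒≥ i≮x)
    ... | (o , refl) = trans (cong +_ (counts-cons-+ x o vs)) (sym (q^-⊛-+ (tri x) (counts vs) o))

  -- The first entry runs over `suc m` values, that is all x < N and `o` further ones, which do not
  -- matter modulo q^N.
  counts-vecsUpTo : ∀ k o {m} → N ℕ.+ o ≡ suc m → counts (vecsUpTo m k) ≈ t-series k →
                    counts (vecsUpTo m (suc k)) ≈ ψ N ⊛ t-series k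
  counts-vecsUpTo k o {m} N+o≡ ih = begin
    counts (vecsUpTo m (suc k))
      ≈⟨ counts-concatMap (suc m) (vecsUpTo m k) ⟩
    ψ (suc m) ⊛ counts (vecsUpTo m k)
      ≡⟨ cong (λ n → ψ n ⊛ counts (vecsUpTo m k))
           (trans (sym N+o≡) (ℕₚ.+-comm N o)) ⟩
    ψ (o ℕ.+ N) ⊛ counts (vecsUpTo m k)
      ≈⟨ *-cong (ψ-stable o) ih ⟩
    ψ N ⊛ t-series k ∎

-- In `t k i` the bound on the entries varies with i, so `t-series` is not the generating function
-- of one list. This lemma allows a common bound for all indices up to m.
counts-stable : ∀ k {m i} → i ℕ.≤ m → counts (vecsUpTo m k) i ≡ t-series k i
counts-stable zero    i≤m = refl
counts-stable (suc k) {m} {i} i≤m with ℕₚ.m≤n⇒∃[o]m+o≡n i≤m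
... | (o , i+o≡m) = trans
  (coeff (counts-vecsUpTo k o (cong suc i+o≡m)
    (below λ j<i → counts-stable k (ℕₚ.≤-trans (ℕₚ.≤-pred j<i) i≤m))) ℕₚ.≤-refl)
  -- The case o = 0 is the bound m = i used in the definition of `t`. Both bounds yield the same
  -- product modulo q^(i+1).
  (sym (coeff (counts-vecsUpTo k 0 (ℕₚ.+-identityʳ (suc i))
    (below λ j<i → counts-stable k (ℕₚ.≤-pred j<i))) ℕₚ.≤-refl))
  where open Truncated (suc i)

t-series-suc : ∀ N k → t-series (suc k) ≈[ N ] Truncated.ψ N N ⊛ t-series k
t-series-suc N k = ≈-trans (≈-sym (below λ i<N → counts-stable (suc k) (ℕₚ.<⇒≤ i<N)))
  (Truncated.counts-vecsUpTo N k 1 (ℕₚ.+-comm N 1) (below λ i<N → counts-stable k (ℕₚ.<⇒≤ i<N)))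
  where open CommutativeRing (seriesRing N) using () renaming (trans to ≈-trans; sym to ≈-sym)

-- This is θ(ψᵏ) = k ψᵏ S, by induction on k: each further factor ψ contributes one more summand ψᵏ
-- S through the Leibniz rule.
θ-t-series : ∀ N k → θ (t-series k) ≈[ N ] const (+ k) ⊛ (t-series k ⊛ σ-series)
θ-t-series N zero = exactly λ i → trans (θ-t₀ i)
  (sym (const-⊛ 0ℤ (t-series 0 ⊛ σ-series) i))
  where
  θ-t₀ : ∀ i → θ (t-series 0) i ≡ 0ℤ
  θ-t₀ zero    = refl
  θ-t₀ (suc i) = ℤₚ.*-zeroʳ (+ suc i)
θ-t-series N (suc k) = begin
  θ (t-series (suc k))
    ≈⟨ θ-cong (t-series-suc N k) ⟩
  θ (Ψ ⊛ t-series k)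
    ≈⟨ exactly (θ-⊛ Ψ (t-series k)) ⟩
  θ Ψ ⊛ t-series k ⊕ Ψ ⊛ θ (t-series k)
    ≈⟨ +-cong (*-congʳ (Truncated.θψ N)) (*-congˡ (θ-t-series N k)) ⟩
  σ-series ⊛ Ψ ⊛ t-series k ⊕ Ψ ⊛ (const (+ k) ⊛ (t-series k ⊛ σ-series))
    ≈⟨ solve 4 (λ S ψ t k → S :* ψ :* t :+ ψ :* (k :* (t :* S)) := (con 1ℤ :+ k) :* (ψ :* t :* S)) ≈-refl
         σ-series Ψ (t-series k) (const (+ k)) ⟩
  (const 1ℤ ⊕ const (+ k)) ⊛ (Ψ ⊛ t-series k ⊛ σ-series)
    ≈⟨ *-cong (exactly {f = const 1ℤ ⊕ const (+ k)} λ { zero → refl ; (suc _) → refl })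
              (*-congʳ (≈-sym (t-series-suc N k))) ⟩
  const (+ suc k) ⊛ (t-series (suc k) ⊛ σ-series) ∎
  where
  open CommutativeRing (seriesRing N) using (setoid; +-cong; *-cong; *-congˡ; *-congʳ)
    renaming (refl to ≈-refl; sym to ≈-sym)
  open SeriesSolver N
  open Relation.Binary.Reasoning.Setoid setoid
  Ψ : Series
  Ψ = Truncated.ψ N N

-- Convolutions as finite sums, and comparison of coefficients

sumBelow-suc : ∀ n h → sumBelow (suc n) h ≡ h 0 ℤ.+ sumBelow n (h ∘ suc)
sumBelow-suc zero    h = ℤₚ.+-comm 0ℤ (h 0)
sumBelow-suc (suc n) h = trans (cong (ℤ._+ h (suc n)) (sumBelow-suc n h))
                               (ℤₚ.+-assoc (h 0) _ _)

sumBelow-cong : ∀ n {g h} → (∀ {j} → j ℕ.< n → g j ≡ h j) → sumBelow n g ≡ sumBelow n h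
sumBelow-cong zero    g≡h = refl
sumBelow-cong (suc n) g≡h =
  cong₂ ℤ._+_ (sumBelow-cong n (λ j<n → g≡h (ℕₚ.m≤n⇒m≤1+n j<n))) (g≡h ℕₚ.≤-refl)

⊛-sumBelow : ∀ f g n → (f ⊛ g) n ≡ sumBelow (suc n) (λ j → f j * g (n ∸ j))
⊛-sumBelow f g zero    = sym (ℤₚ.+-identityˡ _)
⊛-sumBelow f g (suc n) = trans (cong (λ z → f 0 * g (suc n) ℤ.+ z) (⊛-sumBelow (tail f) g n))
  (sym (sumBelow-suc (suc n) (λ j → f j * g (suc n ∸ j))))

theorem2p4 : (k n : ℕ) →
    + n * + t k n
    ≡ + k * sumBelow n (λ j → + t k j * (+ σ (n ∸ j) - + 4 * + σHalf (n ∸ j)))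
theorem2p4 k n = begin
  + n * + t k n
    -- Working modulo q^(n+1) retains the coefficient of qⁿ.
    ≡⟨ coeff (θ-t-series (suc n) k) ℕₚ.≤-refl ⟩
  (const (+ k) ⊛ (t-series k ⊛ σ-series)) n
    ≡⟨ const-⊛ (+ k) (t-series k ⊛ σ-series) n ⟩
  + k * (t-series k ⊛ σ-series) n
    ≡⟨ cong (+ k *_) (trans (⊛-sumBelow (t-series k) σ-series n)
         (trans (cong₂ ℤ._+_ (sumBelow-cong n term) last-term) (ℤₚ.+-identityʳ _))) ⟩
  + k * sumBelow n (λ j → + t k j * (+ σ (n ∸ j) - + 4 * + σHalf (n ∸ j))) ∎
  where
  open ≡-Reasoning
  -- The convolution runs up to j = n, one term further than the sum in the theorem; the zero
  -- constant term of `σ-series` removes it.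
  last-term : + t k n * σ-series (n ∸ n) ≡ 0ℤ
  last-term = trans (cong (λ m → + t k n * σ-series m) (ℕₚ.n∸n≡0 n)) (ℤₚ.*-zeroʳ (+ t k n))

  σ-series-pos : ∀ {m} → 0 ℕ.< m → σ-series m ≡ + σ m - + 4 * + σHalf m
  σ-series-pos (s≤s _) = refl

  term : ∀ {j} → j ℕ.< n → + t k j * σ-series (n ∸ j)
                           ≡ + t k j * (+ σ (n ∸ j) - + 4 * + σHalf (n ∸ j))
  term {j} j<n = cong (+ t k j *_) (σ-series-pos (ℕₚ.m<n⇒0<n∸m j<n))
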